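{- Let $G$ be a finite simple undirected graph with at least one edge, and let $\rho$ denote the number of distinct elements in the degree sequence of $G$ (i.e. the number of distinct values taken by the degrees of the vertices of $G$). Then the regular number of $G$ satisfies $r(G) \ge \left\lceil \log_2 \rho \right\rceil$.
   Context: For a set $F$ of edges of a graph $G$, the subgraph induced by $F$, denoted $\langle F \rangle$, is the graph whose edge set is $F$ and whose vertex set is the set of endpoints of edges in $F$ (it need not contain all the vertices of $G$). The regular number $r(G)$ of a graph $G=(V,E)$ is the minimum number of nonempty subsets into which the edge set $E$ can be partitioned so that the subgraph induced by each subset is regular (i.e. all of its vertices have the same degree; different subsets may have different degrees of regularity, and the induced subgraphs need not be connected). The degree sequence of a graph lists the degrees of all its vertices; for example, $K_{1,4}$ has degree sequence $(1,1,1,1,4)$, which contains two distinct elements. -}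

module Defs where

open import Data.Fin.Base using (Fin)
open import Data.Fin.Properties using (any?; all?) renaming (_≟_ to _≟ᶠ_)
open import Data.Fin.Subset using (Subset; _∈_; _∩_; ∣_∣; ⁅_⁆; Nonempty; Empty)
open import Data.Fin.Subset.Properties
  using (_∈?_; nonempty?; anySubset?; x∈⁅x⁆; x∈⁅y⁆⇒x≡y; x∈p∩q⁺; x∈p∩q⁻
        ; p∩q⊆p; ⊆-antisym)
open import Data.List.Base using (List; length; map; allFin; deduplicate)
open import Data.Nat.Base using (ℕ; zero; suc; _≤_; _<_)
open import Data.Nat.Induction using (<-rec)
open import Data.Nat.Properties using (_≟_; anyUpTo?; ≮⇒≥)
open import Data.Product.Base using (∃; _×_; _,_; proj₁; proj₂)
open import Data.Vec.Base using (Vec; []; _∷_; lookup; tabulate)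
open import Data.Vec.Properties
  using (lookup∘tabulate; lookup⇒[]=; []=⇒lookup)
open import Function.Base using (_∘_)
open import Function.Definitions using (Injective)
open import Level using (0ℓ)
open import Relation.Binary.PropositionalEquality
  using (_≡_; _≢_; refl; sym; trans; cong; subst)
open import Relation.Nullary using (Dec; yes; no; ¬?)
open import Relation.Nullary.Decidable using (map′; _×-dec_; _→-dec_)
open import Relation.Unary using (Pred; Decidable)

-- A finite simple graph: a finite set of vertices together with a set of
-- two-element subsets of it.  Injectivity of the enumeration of the edges
-- excludes multiple edges, and the cardinality condition excludes loops.
record Graph : Set where
  field
    ∣V∣            : ℕ
    ∣E∣            : ℕ
    edge           : Fin ∣E∣ → Subset ∣V∣
    edge-size      : ∀ e → ∣ edge e ∣ ≡ 2
    edge-injective : Injective _≡_ _≡_ edge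

  Vertex : Set
  Vertex = Fin ∣V∣

  EdgeSet : Set
  EdgeSet = Subset ∣E∣

  incident : Vertex → EdgeSet
  incident v = tabulate (λ e → lookup (edge e) v)

  degree : Vertex → ℕ
  degree v = ∣ incident v ∣

  degreeSequence : List ℕ
  degreeSequence = map degree (allFin ∣V∣)

  ρ : ℕ
  ρ = length (deduplicate _≟_ degreeSequence)

open Graph public

∈-incident⁺ : ∀ G {v e} → v ∈ edge G e → e ∈ incident G v
∈-incident⁺ G {v} {e} v∈e =
  lookup⇒[]= e _ (trans (lookup∘tabulate _ e) ([]=⇒lookup v∈e))

∈-incident⁻ : ∀ G {v e} → e ∈ incident G v → v ∈ edge G e
∈-incident⁻ G {v} {e} e∈v =
  lookup⇒[]= v _ (trans (sym (lookup∘tabulate _ e)) ([]=⇒lookup e∈v))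

record Subgraph (G : Graph) : Set₁ where
  field
    vertices : Pred (Vertex G) 0ℓ
    edges    : EdgeSet G
    closed   : ∀ {e v} → e ∈ edges → v ∈ edge G e → vertices v

  degreeIn : Vertex G → ℕ
  degreeIn v = ∣ edges ∩ incident G v ∣

  Regular : Set
  Regular = ∀ u v → vertices u → vertices v → degreeIn u ≡ degreeIn v

open Subgraph public

⟨_⟩ : ∀ {G} → EdgeSet G → Subgraph G
⟨_⟩ {G} F = record
  { vertices = λ v → ∃ λ e → e ∈ F × v ∈ edge G e
  ; edges    = F
  ; closed   = λ e∈F v∈e → _ , e∈F , v∈e
  }

-- Disjoint nonempty blocks are distinct, so the length of the vector is the
-- number of blocks.
record IsPartition {m k} (blocks : Vec (Subset m) k) : Set where
  field
    nonempty : ∀ i → Nonempty (lookup blocks i)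
    disjoint : ∀ i j → i ≢ j → Empty (lookup blocks i ∩ lookup blocks j)
    covers   : ∀ e → ∃ λ i → e ∈ lookup blocks i

record IsRegularPartition (G : Graph) {k} (blocks : Vec (EdgeSet G) k) : Set where
  field
    isPartition : IsPartition blocks
    regular     : ∀ i → Regular (⟨_⟩ {G} (lookup blocks i))

HasRegularPartition : Graph → ℕ → Set
HasRegularPartition G k = ∃ λ (blocks : Vec (EdgeSet G) k) → IsRegularPartition G blocks

IsLeast : Pred ℕ 0ℓ → Pred ℕ 0ℓ
IsLeast P n = P n × (∀ m → P m → n ≤ m)

isPartition? : ∀ {m k} (blocks : Vec (Subset m) k) → Dec (IsPartition blocks)
isPartition? blocks = map′
  (λ (n , d , c) → record { nonempty = n ; disjoint = d ; covers = c })
  (λ p → let open IsPartition p in nonempty , disjoint , covers)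
  (all? (λ i → nonempty? (lookup blocks i))
    ×-dec all? (λ i → all? λ j →
      ¬? (i ≟ᶠ j) →-dec ¬? (nonempty? (lookup blocks i ∩ lookup blocks j)))
    ×-dec all? (λ e → any? λ i → e ∈? lookup blocks i))

vertices⟨⟩? : ∀ G (F : EdgeSet G) → Decidable (vertices (⟨_⟩ {G} F))
vertices⟨⟩? G F v = any? λ e → (e ∈? F) ×-dec (v ∈? edge G e)

regular⟨⟩? : ∀ G (F : EdgeSet G) → Dec (Regular (⟨_⟩ {G} F))
regular⟨⟩? G F = all? λ u → all? λ v →
  vertices⟨⟩? G F u →-dec (vertices⟨⟩? G F v →-dec
    (degreeIn (⟨_⟩ {G} F) u ≟ degreeIn (⟨_⟩ {G} F) v))

isRegularPartition? : ∀ G {k} (blocks : Vec (EdgeSet G) k) →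
                      Dec (IsRegularPartition G blocks)
isRegularPartition? G blocks = map′
  (λ (p , r) → record { isPartition = p ; regular = r })
  (λ q → let open IsRegularPartition q in isPartition , regular)
  (isPartition? blocks ×-dec all? (λ i → regular⟨⟩? G (lookup blocks i)))

anySubsets? : ∀ {m} k {P : Pred (Vec (Subset m) k) 0ℓ} → Decidable P → Dec (∃ P)
anySubsets? zero    P? = map′ (λ p → [] , p) (λ { ([] , p) → p }) (P? [])
anySubsets? (suc k) P? = map′
  (λ (F , Fs , p) → F ∷ Fs , p)
  (λ { (F ∷ Fs , p) → F , Fs , p })
  (anySubset? λ F → anySubsets? k λ Fs → P? (F ∷ Fs))

hasRegularPartition? : ∀ G → Decidable (HasRegularPartition G)
hasRegularPartition? G k = anySubsets? k (isRegularPartition? G)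

singletons : ∀ m → Vec (Subset m) m
singletons m = tabulate ⁅_⁆

∈-singletons⁻ : ∀ {m} (i : Fin m) {e} → e ∈ lookup (singletons m) i → e ≡ i
∈-singletons⁻ i {e} = x∈⁅y⁆⇒x≡y i ∘ subst (e ∈_) (lookup∘tabulate ⁅_⁆ i)

∈-singletons⁺ : ∀ {m} (i : Fin m) → i ∈ lookup (singletons m) i
∈-singletons⁺ i = subst (i ∈_) (sym (lookup∘tabulate ⁅_⁆ i)) (x∈⁅x⁆ i)

singletons-isPartition : ∀ m → IsPartition (singletons m)
singletons-isPartition m = record
  { nonempty = λ i → i , ∈-singletons⁺ i
  ; disjoint = λ i j i≢j (e , e∈) →
      let e∈i , e∈j = x∈p∩q⁻ _ _ e∈
      in i≢j (trans (sym (∈-singletons⁻ i e∈i)) (∈-singletons⁻ j e∈j))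
  ; covers   = λ e → e , ∈-singletons⁺ e
  }

singletons-regular : ∀ G i → Regular (⟨_⟩ {G} (lookup (singletons (∣E∣ G)) i))
singletons-regular G i u v u∈ v∈ =
  cong ∣_∣ (trans (absorb u u∈) (sym (absorb v v∈)))
  where
  F = lookup (singletons (∣E∣ G)) i

  absorb : ∀ w → vertices (⟨_⟩ {G} F) w → F ∩ incident G w ≡ F
  absorb w (e , e∈F , w∈e) = ⊆-antisym (p∩q⊆p F _) λ {e′} e′∈F →
    let e≡e′ = trans (∈-singletons⁻ i e∈F) (sym (∈-singletons⁻ i e′∈F))
    in x∈p∩q⁺ (e′∈F , ∈-incident⁺ G (subst (λ x → w ∈ edge G x) e≡e′ w∈e))

-- The edges taken one at a time form a regular partition.
hasRegularPartition : ∀ G → HasRegularPartition G (∣E∣ G)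
hasRegularPartition G = singletons (∣E∣ G) , record
  { isPartition = singletons-isPartition (∣E∣ G)
  ; regular     = singletons-regular G
  }

least : ∀ {P : Pred ℕ 0ℓ} → Decidable P → ∀ n → P n → ∃ (IsLeast P)
least {P} P? = <-rec (λ n → P n → ∃ (IsLeast P)) step
  where
  step : ∀ n → (∀ {m} → m < n → P m → ∃ (IsLeast P)) → P n → ∃ (IsLeast P)
  step n rec Pn with anyUpTo? P? n
  ... | yes (m , m<n , Pm) = rec m<n Pm
  ... | no ∄               = n , Pn , λ m Pm → ≮⇒≥ λ m<n → ∄ (m , m<n , Pm)

leastRegularPartition : ∀ G → ∃ (IsLeast (HasRegularPartition G))
leastRegularPartition G =
  least (hasRegularPartition? G) (∣E∣ G) (hasRegularPartition G)

regularNumber : Graph → ℕ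
regularNumber G = proj₁ (leastRegularPartition G)

regularNumber-isLeast : ∀ G → IsLeast (HasRegularPartition G) (regularNumber G)
regularNumber-isLeast G = proj₂ (leastRegularPartition G)

{-# OPTIONS --safe #-}

-- Fix a regular partition into k blocks, the i-th one regular of degree dᵢ.
-- The edges at a vertex v are distributed among the blocks, and block i
-- contributes dᵢ of them if it reaches v and none otherwise.  So every degree
-- of G is a subset sum of d₁, …, dₖ, and there are at most 2ᵏ of those.
module Submission where

open import Defs
open import Data.Bool.Base using (true; false)
open import Data.Fin.Base using (Fin; zero; suc)
open import Data.Fin.Properties using (injective⇒≤; suc-injective)
open import Data.Fin.Subset using (Subset; _∈_; _∉_; _∩_; _─_; ∣_∣; Nonempty; Empty)
open import Data.Fin.Subset.Properties
  using (nonempty?; Empty-unique; ∣⊥∣≡0; x∈p∩q⁺; x∈p∩q⁻; p─q⊆p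
        ; x∈p∧x∉q⇒x∈p─q; ⊆-antisym)
open import Data.List.Base using (List; []; _∷_; [_]; _++_; map; length; lookup; deduplicate)
import Data.List.Membership.Propositional as List
open import Data.List.Membership.Propositional.Properties
  using (∈-++⁺ˡ; ∈-++⁺ʳ; ∈-map⁺; ∈-map⁻; ∈-lookup; ∈-deduplicate⁻)
open import Data.List.Membership.Setoid.Properties using (index-injective)
open import Data.List.Properties using (length-++; length-map)
open import Data.List.Relation.Binary.Subset.Propositional using (_⊆_)
import Data.List.Relation.Unary.All as All
open import Data.List.Relation.Unary.AllPairs using (_∷_)
open import Data.List.Relation.Unary.Any using (here)
open import Data.List.Relation.Unary.Unique.DecPropositional.Properties using (deduplicate-!)
open import Data.List.Relation.Unary.Unique.Propositional using (Unique)
open import Data.Nat.Base using (ℕ; zero; suc; _+_; _^_; _≤_)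
open import Data.Nat.Logarithm using (⌈log₂_⌉; ⌈log₂⌉-mono-≤; ⌈log₂2^n⌉≡n)
open import Data.Nat.Properties using (_≟_; +-0-monoid; +-identityʳ; +-suc; module ≤-Reasoning)
open import Data.Product.Base using (∃; _,_; proj₁; proj₂)
open import Data.Sum.Base using (_⊎_; inj₁; inj₂)
open import Data.Vec.Base using ([]; _∷_; there) renaming (lookup to lookupᵛ)
open import Function.Base using (_∘_)
open import Relation.Binary.PropositionalEquality
  using (_≡_; _≢_; refl; sym; trans; cong; cong₂; subst; setoid; module ≡-Reasoning)
open import Relation.Nullary using (yes; no; contradiction)

open import Algebra.Properties.Monoid.Sum +-0-monoid using (sum; sum-cong-≗)

lookup-injective : ∀ {a} {A : Set a} {xs : List A} → Unique xs →
                   ∀ i j → lookup xs i ≡ lookup xs j → i ≡ j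
lookup-injective (_    ∷ _)   zero    zero    _  = refl
lookup-injective (x≢xs ∷ _)   zero    (suc j) eq = contradiction eq (All.lookup x≢xs (∈-lookup j))
lookup-injective (x≢xs ∷ _)   (suc i) zero    eq = contradiction (sym eq) (All.lookup x≢xs (∈-lookup i))
lookup-injective (_    ∷ xs!) (suc i) (suc j) eq = cong suc (lookup-injective xs! i j eq)

-- Each position of `xs` goes to the position in `ys` that its membership proof names. Equal
-- positions in `ys` force equal entries of `xs`, hence equal positions by uniqueness.
Unique-⊆⇒length≤ : ∀ {a} {A : Set a} {xs ys : List A} →
                   Unique xs → xs ⊆ ys → length xs ≤ length ys
Unique-⊆⇒length≤ {A = A} {xs} xs! xs⊆ys = injective⇒≤ λ {i} {j} →
  lookup-injective xs! i j ∘
  index-injective (setoid A) (xs⊆ys (∈-lookup i)) (xs⊆ys (∈-lookup j))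

-- Coinciding sums are kept, one entry per subset of the indices, so the length depends on `k`
-- alone.
subsetSums : ∀ {k} → (Fin k → ℕ) → List ℕ
subsetSums {zero}  d = [ 0 ]
subsetSums {suc k} d = subsetSums (d ∘ suc) ++ map (d zero +_) (subsetSums (d ∘ suc))

length-subsetSums : ∀ {k} (d : Fin k → ℕ) → length (subsetSums d) ≡ 2 ^ k
length-subsetSums {zero}  d = refl
length-subsetSums {suc k} d = begin
  length (S ++ map (d zero +_) S)         ≡⟨ length-++ S ⟩
  length S + length (map (d zero +_) S)   ≡⟨ cong (length S +_) (length-map _ S) ⟩
  -- `2 ^ suc k` unfolds to `2 ^ k + (2 ^ k + 0)`, which accounts for the trailing zero.
  length S + length S                     ≡⟨ cong₂ _+_ ih (trans ih (sym (+-identityʳ _))) ⟩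
  2 ^ suc k                               ∎
  where
  open ≡-Reasoning
  S = subsetSums (d ∘ suc)
  ih = length-subsetSums (d ∘ suc)

sum∈subsetSums : ∀ {k} (d x : Fin k → ℕ) → (∀ i → x i ≡ 0 ⊎ x i ≡ d i) →
                 sum x List.∈ subsetSums d
sum∈subsetSums {zero}  d x x≡0∨d = here refl
sum∈subsetSums {suc k} d x x≡0∨d
  -- The disjunction at `zero` decides the half of the list: 0 leaves `d zero` out, and `d zero`
  -- lands among the shifted sums.
  with x zero | x≡0∨d zero | sum∈subsetSums (d ∘ suc) (x ∘ suc) (x≡0∨d ∘ suc)
... | _ | inj₁ refl | Σx∈ = ∈-++⁺ˡ Σx∈
... | _ | inj₂ refl | Σx∈ = ∈-++⁺ʳ _ (∈-map⁺ (d zero +_) Σx∈)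

Empty⇒∣p∣≡0 : ∀ {n} {p : Subset n} → Empty p → ∣ p ∣ ≡ 0
Empty⇒∣p∣≡0 {n} ∄ = trans (cong ∣_∣ (Empty-unique ∄)) (∣⊥∣≡0 n)

∣p∣≢0⇒Nonempty : ∀ {n} {p : Subset n} → ∣ p ∣ ≢ 0 → Nonempty p
∣p∣≢0⇒Nonempty {p = p} ∣p∣≢0 with nonempty? p
... | yes p≠∅ = p≠∅
... | no  p=∅ = contradiction (Empty⇒∣p∣≡0 p=∅) ∣p∣≢0

∣q∩p∣+∣p─q∣≡∣p∣ : ∀ {n} (p q : Subset n) → ∣ q ∩ p ∣ + ∣ p ─ q ∣ ≡ ∣ p ∣
∣q∩p∣+∣p─q∣≡∣p∣ []          []          = refl
∣q∩p∣+∣p─q∣≡∣p∣ (false ∷ p) (false ∷ q) = ∣q∩p∣+∣p─q∣≡∣p∣ p q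
∣q∩p∣+∣p─q∣≡∣p∣ (false ∷ p) (true  ∷ q) = ∣q∩p∣+∣p─q∣≡∣p∣ p q
∣q∩p∣+∣p─q∣≡∣p∣ (true  ∷ p) (false ∷ q) = trans (+-suc _ _) (cong suc (∣q∩p∣+∣p─q∣≡∣p∣ p q))
∣q∩p∣+∣p─q∣≡∣p∣ (true  ∷ p) (true  ∷ q) = cong suc (∣q∩p∣+∣p─q∣≡∣p∣ p q)

x∈p─q⇒x∉q : ∀ {n x} (p q : Subset n) → x ∈ p ─ q → x ∉ q
-- Position zero needs no clause: a `false` head keeps it out of `q`, a `true` head out of `p ─ q`.
x∈p─q⇒x∉q (_ ∷ p) (false ∷ q) (there x∈) (there x∈q) = x∈p─q⇒x∉q p q x∈ x∈q
x∈p─q⇒x∉q (_ ∷ p) (true  ∷ q) (there x∈) (there x∈q) = x∈p─q⇒x∉q p q x∈ x∈q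

disjoint⇒r∩[p─q]≡r∩p : ∀ {n} (p : Subset n) {q r} → Empty (r ∩ q) → r ∩ (p ─ q) ≡ r ∩ p
disjoint⇒r∩[p─q]≡r∩p p {q} {r} r∩q=∅ = ⊆-antisym
  (λ x∈ → let x∈r , x∈p─q = x∈p∩q⁻ r (p ─ q) x∈ in x∈p∩q⁺ (x∈r , p─q⊆p p q x∈p─q))
  (λ x∈ → let x∈r , x∈p = x∈p∩q⁻ r p x∈
          in x∈p∩q⁺ (x∈r , x∈p∧x∉q⇒x∈p─q x∈p λ x∈q → r∩q=∅ (_ , x∈p∩q⁺ (x∈r , x∈q))))

-- Induction on the number of blocks: the first block is cut out of `p`, and the others must cover
-- what remains. Being disjoint from the first block, they meet `p` and the remainder in the same
-- elements.
sum-∣∩∣ : ∀ {n k} (F : Fin k → Subset n) →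
          (∀ i j → i ≢ j → Empty (F i ∩ F j)) →
          (p : Subset n) → (∀ {x} → x ∈ p → ∃ λ i → x ∈ F i) →
          sum (λ i → ∣ F i ∩ p ∣) ≡ ∣ p ∣
sum-∣∩∣ {k = zero}  F disjoint p covers =
  sym (Empty⇒∣p∣≡0 λ (x , x∈p) → contradiction (proj₁ (covers x∈p)) λ ())
sum-∣∩∣ {k = suc k} F disjoint p covers = begin
  ∣ F₀ ∩ p ∣ + sum (λ i → ∣ F (suc i) ∩ p ∣)         ≡⟨ cong (∣ F₀ ∩ p ∣ +_) (sum-cong-≗ restrict) ⟨
  ∣ F₀ ∩ p ∣ + sum (λ i → ∣ F (suc i) ∩ (p ─ F₀) ∣)  ≡⟨ cong (∣ F₀ ∩ p ∣ +_) ih ⟩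
  ∣ F₀ ∩ p ∣ + ∣ p ─ F₀ ∣                            ≡⟨ ∣q∩p∣+∣p─q∣≡∣p∣ p F₀ ⟩
  ∣ p ∣                                              ∎
  where
  open ≡-Reasoning
  F₀ = F zero

  restrict : ∀ i → ∣ F (suc i) ∩ (p ─ F₀) ∣ ≡ ∣ F (suc i) ∩ p ∣
  restrict i = cong ∣_∣ (disjoint⇒r∩[p─q]≡r∩p p (disjoint (suc i) zero λ ()))

  covers′ : ∀ {x} → x ∈ p ─ F₀ → ∃ λ i → x ∈ F (suc i)
  covers′ x∈p─F₀ with covers (p─q⊆p p F₀ x∈p─F₀)
  ... | zero  , x∈F₀ = contradiction x∈F₀ (x∈p─q⇒x∉q p F₀ x∈p─F₀)
  ... | suc i , x∈Fᵢ = i , x∈Fᵢ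

  ih = sum-∣∩∣ (F ∘ suc)
    (λ i j i≢j → disjoint (suc i) (suc j) (i≢j ∘ suc-injective)) (p ─ F₀) covers′

edge-nonempty : ∀ G e → Nonempty (edge G e)
edge-nonempty G e = ∣p∣≢0⇒Nonempty λ ∣e∣≡0 →
  contradiction (trans (sym (edge-size G e)) ∣e∣≡0) λ ()

-- The value `d` is read off at an endpoint `u` of some edge of `F`. Regularity carries it to every
-- vertex that `F` reaches; at any other vertex no edge of `F` is incident.
regular-degree : ∀ G (F : EdgeSet G) → Nonempty F → Regular (⟨_⟩ {G} F) →
                 ∃ λ d → ∀ v → ∣ F ∩ incident G v ∣ ≡ 0 ⊎ ∣ F ∩ incident G v ∣ ≡ d
regular-degree G F (e , e∈F) regular = ∣ F ∩ incident G u ∣ , dichotomy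
  where
  u = proj₁ (edge-nonempty G e)
  u∈⟨F⟩ = e , e∈F , proj₂ (edge-nonempty G e)

  dichotomy : ∀ v → ∣ F ∩ incident G v ∣ ≡ 0 ⊎ ∣ F ∩ incident G v ∣ ≡ ∣ F ∩ incident G u ∣
  dichotomy v with vertices⟨⟩? G F v
  ... | yes v∈⟨F⟩ = inj₂ (regular v u v∈⟨F⟩ u∈⟨F⟩)
  ... | no  v∉⟨F⟩ = inj₁ (Empty⇒∣p∣≡0 λ (e′ , e′∈) →
    let e′∈F , e′∋v = x∈p∩q⁻ F (incident G v) e′∈
    in v∉⟨F⟩ (e′ , e′∈F , ∈-incident⁻ G e′∋v))

ρ≤2^k : ∀ G {k} → HasRegularPartition G k → ρ G ≤ 2 ^ k
ρ≤2^k G {k} (blocks , isRegularPartition) = begin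
  ρ G                    ≤⟨ Unique-⊆⇒length≤ (deduplicate-! _≟_ (degreeSequence G)) degrees⊆ ⟩
  length (subsetSums d)  ≡⟨ length-subsetSums d ⟩
  2 ^ k                  ∎
  where
  open ≤-Reasoning
  open IsRegularPartition isRegularPartition
  open IsPartition isPartition

  F : Fin k → EdgeSet G
  F = lookupᵛ blocks

  blockDegree = λ i → regular-degree G (F i) (nonempty i) (regular i)

  d : Fin k → ℕ
  d = proj₁ ∘ blockDegree

  -- The choice of summands varies with `v`, but `d` does not, so a single list captures all
  -- degrees.
  degree∈ : ∀ v → degree G v List.∈ subsetSums d
  degree∈ v = subst (List._∈ subsetSums d)
    (sum-∣∩∣ F disjoint (incident G v) λ {e} _ → covers e)
    (sum∈subsetSums d _ λ i → proj₂ (blockDegree i) v)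

  degrees⊆ : deduplicate _≟_ (degreeSequence G) ⊆ subsetSums d
  degrees⊆ n∈ with ∈-map⁻ (degree G) (∈-deduplicate⁻ _≟_ (degreeSequence G) n∈)
  ... | v , _ , refl = degree∈ v

proposition6 : (G : Graph) → 1 ≤ ∣E∣ G → ⌈log₂ ρ G ⌉ ≤ regularNumber G
proposition6 G _ = begin
  -- The first component of `IsLeast` is a regular partition into exactly `r` blocks, to which the
  -- count applies.
  ⌈log₂ ρ G ⌉        ≤⟨ ⌈log₂⌉-mono-≤ (ρ≤2^k G (proj₁ (regularNumber-isLeast G))) ⟩
  ⌈log₂ 2 ^ r ⌉      ≡⟨ ⌈log₂2^n⌉≡n r ⟩
  r                  ∎
  where
  open ≤-Reasoning
  r = regularNumber G
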